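{- Let $\Gamma=\langle U,V,W\rangle\le \mathrm{SL}_4(\mathbb Z)$ be the group generated by the three matrices $$U=\begin{pmatrix}1&1&1&2\\0&1&0&0\\0&0&1&0\\0&1&1&1\end{pmatrix},\quad V=\begin{pmatrix}1&0&0&0\\1&1&1&2\\0&0&1&0\\1&0&1&1\end{pmatrix},\quad W=\begin{pmatrix}1&0&0&0\\0&1&0&0\\1&1&1&2\\1&1&0&1\end{pmatrix},$$ and let $\gamma^+$ and $\gamma^-$ be the semigroups generated by $U,V,W$ and by $U^{ -1},V^{ -1},W^{ -1}$, respectively. Then there is a six-element subgroup $\Omega<\Gamma$, isomorphic to the symmetric group $S_3$, such that every $g\in\Gamma$ can be written in the form $g=P\omega$ with $\omega\in\Omega$ and with either $P\in\gamma^+$ or $P\in\gamma^-$, where the word $P$ is also allowed to be empty (i.e. $P=I$). Moreover, $\gamma^+$ is a free semigroup on the generators $U,V,W$, and $\gamma^-$ is a free semigroup on the generators $U^{ -1},V^{ -1},W^{ -1}$.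
   Context: A semigroup of matrices generated by a set $S$ consists of all finite products of elements of $S$. It is free on $S$ if two words in $S$ defining the same matrix are identical as words. -}

module Defs where

open import Algebra.Bundles using (Monoid; Group)
open import Algebra.Morphism.Structures using (module GroupMorphisms)
open import Algebra.Properties.Semiring.Sum as Sum using ()
open import Data.Bool.Base using (if_then_else_)
open import Data.Fin.Base using (Fin; zero; suc; toℕ; punchIn)
open import Data.Fin.Patterns using (0F; 1F; 2F)
open import Data.Fin.Permutation as Perm using (Permutation′; _⟨$⟩ʳ_)
open import Data.Fin.Properties as Fin using (all?)
open import Data.Integer.Base using (ℤ; +_; -_; 0ℤ; 1ℤ; -1ℤ; _+_; _*_; _^_)
open import Data.Integer.Properties as ℤ using ()
open import Data.List.NonEmpty.Base as List⁺ using (List⁺)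
open import Data.Nat.Base using (ℕ; zero; suc)
open import Data.Product.Base using (Σ; ∃; _×_; _,_; proj₁; proj₂)
open import Data.Vec.Base using (Vec; []; _∷_; lookup)
open import Data.Vec.Functional using (Vector)
open import Function.Base using (_∘_)
open import Level using (Level; _⊔_; 0ℓ) renaming (suc to lsuc)
open import Relation.Binary.PropositionalEquality as ≡ using (_≡_; refl; cong; cong₂)
open import Relation.Nullary.Decidable using (Dec; does; from-yes)
open import Relation.Unary using (Pred; _∈_)

private
  variable
    c ℓ p i : Level

infix 4 _≅_

_≅_ : ∀ {c₁ ℓ₁ c₂ ℓ₂} → Group c₁ ℓ₁ → Group c₂ ℓ₂ → Set (c₁ ⊔ ℓ₁ ⊔ c₂ ⊔ ℓ₂)
G ≅ H = ∃ λ f → IsGroupIsomorphism f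
  where open GroupMorphisms (Group.rawGroup G) (Group.rawGroup H)

record Subgroup (G : Group c ℓ) (p : Level) : Set (c ⊔ ℓ ⊔ lsuc p) where
  open Group G
  field
    members   : Pred Carrier p
    resp-≈    : ∀ {x y} → x ≈ y → x ∈ members → y ∈ members
    ε-closed  : ε ∈ members
    ∙-closed  : ∀ {x y} → x ∈ members → y ∈ members → x ∙ y ∈ members
    ⁻¹-closed : ∀ {x} → x ∈ members → x ⁻¹ ∈ members

  group : Group (c ⊔ p) ℓ
  group = record
    { Carrier = Σ Carrier members
    ; _≈_     = λ x y → proj₁ x ≈ proj₁ y
    ; _∙_     = λ (x , x∈) (y , y∈) → x ∙ y , ∙-closed x∈ y∈
    ; ε       = ε , ε-closed
    ; _⁻¹     = λ (x , x∈) → x ⁻¹ , ⁻¹-closed x∈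
    ; isGroup = record
      { isMonoid = record
        { isSemigroup = record
          { isMagma = record
            { isEquivalence = record
              { refl = Group.refl G ; sym = sym ; trans = trans }
            ; ∙-cong = ∙-cong
            }
          ; assoc = λ x y z → assoc (proj₁ x) (proj₁ y) (proj₁ z)
          }
        ; identity = (λ x → identityˡ (proj₁ x)) , (λ x → identityʳ (proj₁ x))
        }
      ; inverse = (λ x → inverseˡ (proj₁ x)) , (λ x → inverseʳ (proj₁ x))
      ; ⁻¹-cong = ⁻¹-cong
      }
    }

open Subgroup public using (members)

module _ (G : Group c ℓ) {I : Set i} (S : I → Group.Carrier G) where
  open Group G

  data Generated : Pred Carrier (c ⊔ ℓ ⊔ i) where
    gen  : ∀ k → Generated (S k)
    unit : Generated ε
    mul  : ∀ {x y} → Generated x → Generated y → Generated (x ∙ y)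
    inv  : ∀ {x} → Generated x → Generated (x ⁻¹)
    resp : ∀ {x y} → x ≈ y → Generated x → Generated y

  subgroupGeneratedBy : Subgroup G (c ⊔ ℓ ⊔ i)
  subgroupGeneratedBy = record
    { members   = Generated
    ; resp-≈    = resp
    ; ε-closed  = unit
    ; ∙-closed  = mul
    ; ⁻¹-closed = inv
    }

  -- Semigroup words are nonempty, so the identity is not a member by default.
  evalWord : List⁺ I → Carrier
  evalWord w = List⁺.foldr₁ _∙_ (List⁺.map S w)

  semigroupGeneratedBy : Pred Carrier (ℓ ⊔ i)
  semigroupGeneratedBy g = ∃ λ w → g ≈ evalWord w

  FreelyGenerated : Set (ℓ ⊔ i)
  FreelyGenerated = ∀ v w → evalWord v ≈ evalWord w → v ≡ w

-- The product π ∙ ρ applies ρ first, whereas _∘ₚ_ applies its left argument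
-- first.
symmetricGroup : ℕ → Group 0ℓ 0ℓ
symmetricGroup n = record
  { Carrier = Permutation′ n
  ; _≈_     = Perm._≈_
  ; _∙_     = λ π ρ → ρ Perm.∘ₚ π
  ; ε       = Perm.id
  ; _⁻¹     = Perm.flip
  ; isGroup = record
    { isMonoid = record
      { isSemigroup = record
        { isMagma = record
          { isEquivalence = record
            { refl  = λ _ → refl
            ; sym   = λ π≈ρ k → ≡.sym (π≈ρ k)
            ; trans = λ π≈ρ ρ≈σ k → ≡.trans (π≈ρ k) (ρ≈σ k)
            }
          ; ∙-cong = λ {π} {_} {_} {σ} π≈ρ σ≈τ k →
              ≡.trans (cong (π ⟨$⟩ʳ_) (σ≈τ k)) (π≈ρ _)
          }
        ; assoc = λ _ _ _ _ → refl
        }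
      ; identity = (λ _ _ → refl) , (λ _ _ → refl)
      }
    ; inverse = (λ π _ → Perm.inverseˡ π) , (λ π _ → Perm.inverseʳ π)
    ; ⁻¹-cong = λ {π} {ρ} π≈ρ k →
        ≡.trans (cong (Perm.flip π ⟨$⟩ʳ_) (≡.sym (Perm.inverseʳ ρ)))
       (≡.trans (cong (Perm.flip π ⟨$⟩ʳ_) (≡.sym (π≈ρ _)))
                (Perm.inverseˡ π))
    }
  }

module _ (M : Monoid c ℓ) where
  open Monoid M

  record Unit : Set (c ⊔ ℓ) where
    field
      value    : Carrier
      inverse  : Carrier
      inverseˡ : inverse ∙ value ≈ ε
      inverseʳ : value ∙ inverse ≈ ε

  open Unit

  private
    open import Relation.Binary.Reasoning.Setoid setoid

    cancel : ∀ {x y z w} → x ∙ w ≈ ε → y ∙ z ≈ ε → (y ∙ x) ∙ (w ∙ z) ≈ ε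
    cancel {x} {y} {z} {w} xw≈ε yz≈ε = begin
      (y ∙ x) ∙ (w ∙ z) ≈⟨ assoc y x (w ∙ z) ⟩
      y ∙ (x ∙ (w ∙ z)) ≈⟨ ∙-congˡ (assoc x w z) ⟨
      y ∙ ((x ∙ w) ∙ z) ≈⟨ ∙-congˡ (∙-congʳ xw≈ε) ⟩
      y ∙ (ε ∙ z)       ≈⟨ ∙-congˡ (identityˡ z) ⟩
      y ∙ z             ≈⟨ yz≈ε ⟩
      ε                 ∎

    inverse-cong : ∀ x y → value x ≈ value y → inverse x ≈ inverse y
    inverse-cong x y x≈y = begin
      inverse x                           ≈⟨ identityʳ _ ⟨
      inverse x ∙ ε                       ≈⟨ ∙-congˡ (inverseʳ y) ⟨
      inverse x ∙ (value y ∙ inverse y)   ≈⟨ assoc _ _ _ ⟨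
      (inverse x ∙ value y) ∙ inverse y   ≈⟨ ∙-congʳ (∙-congˡ x≈y) ⟨
      (inverse x ∙ value x) ∙ inverse y   ≈⟨ ∙-congʳ (inverseˡ x) ⟩
      ε ∙ inverse y                       ≈⟨ identityˡ _ ⟩
      inverse y                           ∎

  unitGroup : Group (c ⊔ ℓ) ℓ
  unitGroup = record
    { Carrier = Unit
    ; _≈_     = λ x y → value x ≈ value y
    ; _∙_     = λ x y → record
      { value    = value x ∙ value y
      ; inverse  = inverse y ∙ inverse x
      ; inverseˡ = cancel (inverseˡ x) (inverseˡ y)
      ; inverseʳ = cancel (inverseʳ y) (inverseʳ x)
      }
    ; ε       = record
      { value    = ε
      ; inverse  = ε
      ; inverseˡ = identityˡ ε
      ; inverseʳ = identityˡ ε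
      }
    ; _⁻¹     = λ x → record
      { value    = inverse x
      ; inverse  = value x
      ; inverseˡ = inverseʳ x
      ; inverseʳ = inverseˡ x
      }
    ; isGroup = record
      { isMonoid = record
        { isSemigroup = record
          { isMagma = record
            { isEquivalence = record
              { refl = Monoid.refl M ; sym = sym ; trans = trans }
            ; ∙-cong = ∙-cong
            }
          ; assoc = λ x y z → assoc (value x) (value y) (value z)
          }
        ; identity = (λ x → identityˡ (value x)) , (λ x → identityʳ (value x))
        }
      ; inverse = inverseˡ , inverseʳ
      ; ⁻¹-cong = λ {x} {y} → inverse-cong x y
      }
    }

Matrix : ℕ → Set
Matrix n = Vector (Vector ℤ n) n

open Sum ℤ.+-*-semiring
  using (sum; sum-syntax; sum-cong-≋; ∑-comm; *-distribˡ-sum; *-distribʳ-sum; sum-replicate-zero)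

module _ {n : ℕ} where

  infix  4 _≈ᴹ_ _≟ᴹ_
  infixl 7 _*ᴹ_

  _≈ᴹ_ : Matrix n → Matrix n → Set
  A ≈ᴹ B = ∀ j k → A j k ≡ B j k

  _≟ᴹ_ : ∀ A B → Dec (A ≈ᴹ B)
  A ≟ᴹ B = all? λ j → all? λ k → A j k ℤ.≟ B j k

  _*ᴹ_ : Matrix n → Matrix n → Matrix n
  (A *ᴹ B) j k = ∑[ l < n ] (A j l * B l k)

  1ᴹ : Matrix n
  1ᴹ j k = if does (j Fin.≟ k) then 1ℤ else 0ℤ

  fromRows : Vec (Vec ℤ n) n → Matrix n
  fromRows rows j k = lookup (lookup rows j) k

-- Laplace expansion along the first row.
det : ∀ {n} → Matrix n → ℤ
det {zero}  A = 1ℤ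
det {suc n} A =
  ∑[ k < suc n ] ((-1ℤ ^ toℕ k) * A zero k * det (λ j l → A (suc j) (punchIn k l)))

private
  *ᴹ-assoc : ∀ {n} (A B C : Matrix n) → ((A *ᴹ B) *ᴹ C) ≈ᴹ (A *ᴹ (B *ᴹ C))
  *ᴹ-assoc {n} A B C j k = begin
    ∑[ l < n ] (∑[ m < n ] (A j m * B m l) * C l k)
      ≡⟨ sum-cong-≋ (λ l → *-distribʳ-sum (C l k) (λ m → A j m * B m l)) ⟩
    ∑[ l < n ] ∑[ m < n ] (A j m * B m l * C l k)
      ≡⟨ ∑-comm (λ l m → A j m * B m l * C l k) ⟩
    ∑[ m < n ] ∑[ l < n ] (A j m * B m l * C l k)
      ≡⟨ sum-cong-≋ (λ m → sum-cong-≋ (λ l → ℤ.*-assoc (A j m) (B m l) (C l k))) ⟩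
    ∑[ m < n ] ∑[ l < n ] (A j m * (B m l * C l k))
      ≡⟨ sum-cong-≋ (λ m → *-distribˡ-sum (A j m) (λ l → B m l * C l k)) ⟨
    ∑[ m < n ] (A j m * ∑[ l < n ] (B m l * C l k))
      ∎
    where open ≡.≡-Reasoning

  sum-zero : ∀ {n} (f : Vector ℤ n) → (∀ k → f k ≡ 0ℤ) → sum f ≡ 0ℤ
  sum-zero {n} f f≡0 = ≡.trans (sum-cong-≋ f≡0) (sum-replicate-zero n)

  sum-1ᴹˡ : ∀ {n} (j : Fin n) (v : Vector ℤ n) → ∑[ l < n ] (1ᴹ j l * v l) ≡ v j
  sum-1ᴹˡ zero v = ≡.trans
    (cong₂ _+_ (ℤ.*-identityˡ (v zero)) (sum-zero _ (λ l → ℤ.*-zeroˡ (v (suc l)))))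
    (ℤ.+-identityʳ (v zero))
  sum-1ᴹˡ (suc j) v = ≡.trans
    (cong₂ _+_ (ℤ.*-zeroˡ (v zero)) (sum-1ᴹˡ j (v ∘ suc)))
    (ℤ.+-identityˡ (v (suc j)))

  sum-1ᴹʳ : ∀ {n} (k : Fin n) (v : Vector ℤ n) → ∑[ l < n ] (v l * 1ᴹ l k) ≡ v k
  sum-1ᴹʳ zero v = ≡.trans
    (cong₂ _+_ (ℤ.*-identityʳ (v zero)) (sum-zero _ (λ l → ℤ.*-zeroʳ (v (suc l)))))
    (ℤ.+-identityʳ (v zero))
  sum-1ᴹʳ (suc k) v = ≡.trans
    (cong₂ _+_ (ℤ.*-zeroʳ (v zero)) (sum-1ᴹʳ k (v ∘ suc)))
    (ℤ.+-identityˡ (v (suc k)))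

matrixMonoid : ℕ → Monoid 0ℓ 0ℓ
matrixMonoid n = record
  { Carrier  = Matrix n
  ; _≈_      = _≈ᴹ_
  ; _∙_      = _*ᴹ_
  ; ε        = 1ᴹ
  ; isMonoid = record
    { isSemigroup = record
      { isMagma = record
        { isEquivalence = record
          { refl  = λ _ _ → refl
          ; sym   = λ A≈B j k → ≡.sym (A≈B j k)
          ; trans = λ A≈B B≈C j k → ≡.trans (A≈B j k) (B≈C j k)
          }
        ; ∙-cong = λ A≈B C≈D j k → sum-cong-≋ (λ l → cong₂ _*_ (A≈B j l) (C≈D l k))
        }
      ; assoc = *ᴹ-assoc
      }
    ; identity = (λ A j k → sum-1ᴹˡ j (λ l → A l k)) , (λ A j k → sum-1ᴹʳ k (A j))
    }
  }

GL : ℕ → Group 0ℓ 0ℓ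
GL n = unitGroup (matrixMonoid n)

SL : ∀ n → Pred (Group.Carrier (GL n)) 0ℓ
SL n g = det (Unit.value g) ≡ 1ℤ

private
  2ℤ -2ℤ : ℤ
  2ℤ  = + 2
  -2ℤ = - 2ℤ

U V W : Group.Carrier (GL 4)

U = record
  { value    = A
  ; inverse  = B
  ; inverseˡ = from-yes (B *ᴹ A ≟ᴹ 1ᴹ)
  ; inverseʳ = from-yes (A *ᴹ B ≟ᴹ 1ᴹ)
  }
  where
  A B : Matrix 4
  A = fromRows
    ( (1ℤ ∷ 1ℤ ∷ 1ℤ ∷ 2ℤ ∷ [])
    ∷ (0ℤ ∷ 1ℤ ∷ 0ℤ ∷ 0ℤ ∷ [])
    ∷ (0ℤ ∷ 0ℤ ∷ 1ℤ ∷ 0ℤ ∷ [])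
    ∷ (0ℤ ∷ 1ℤ ∷ 1ℤ ∷ 1ℤ ∷ [])
    ∷ [])
  B = fromRows
    ( (1ℤ ∷  1ℤ ∷  1ℤ ∷ -2ℤ ∷ [])
    ∷ (0ℤ ∷  1ℤ ∷  0ℤ ∷  0ℤ ∷ [])
    ∷ (0ℤ ∷  0ℤ ∷  1ℤ ∷  0ℤ ∷ [])
    ∷ (0ℤ ∷ -1ℤ ∷ -1ℤ ∷  1ℤ ∷ [])
    ∷ [])

V = record
  { value    = A
  ; inverse  = B
  ; inverseˡ = from-yes (B *ᴹ A ≟ᴹ 1ᴹ)
  ; inverseʳ = from-yes (A *ᴹ B ≟ᴹ 1ᴹ)
  }
  where
  A B : Matrix 4
  A = fromRows
    ( (1ℤ ∷ 0ℤ ∷ 0ℤ ∷ 0ℤ ∷ [])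
    ∷ (1ℤ ∷ 1ℤ ∷ 1ℤ ∷ 2ℤ ∷ [])
    ∷ (0ℤ ∷ 0ℤ ∷ 1ℤ ∷ 0ℤ ∷ [])
    ∷ (1ℤ ∷ 0ℤ ∷ 1ℤ ∷ 1ℤ ∷ [])
    ∷ [])
  B = fromRows
    ( ( 1ℤ ∷ 0ℤ ∷  0ℤ ∷  0ℤ ∷ [])
    ∷ ( 1ℤ ∷ 1ℤ ∷  1ℤ ∷ -2ℤ ∷ [])
    ∷ ( 0ℤ ∷ 0ℤ ∷  1ℤ ∷  0ℤ ∷ [])
    ∷ (-1ℤ ∷ 0ℤ ∷ -1ℤ ∷  1ℤ ∷ [])
    ∷ [])

W = record
  { value    = A
  ; inverse  = B
  ; inverseˡ = from-yes (B *ᴹ A ≟ᴹ 1ᴹ)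
  ; inverseʳ = from-yes (A *ᴹ B ≟ᴹ 1ᴹ)
  }
  where
  A B : Matrix 4
  A = fromRows
    ( (1ℤ ∷ 0ℤ ∷ 0ℤ ∷ 0ℤ ∷ [])
    ∷ (0ℤ ∷ 1ℤ ∷ 0ℤ ∷ 0ℤ ∷ [])
    ∷ (1ℤ ∷ 1ℤ ∷ 1ℤ ∷ 2ℤ ∷ [])
    ∷ (1ℤ ∷ 1ℤ ∷ 0ℤ ∷ 1ℤ ∷ [])
    ∷ [])
  B = fromRows
    ( ( 1ℤ ∷  0ℤ ∷ 0ℤ ∷  0ℤ ∷ [])
    ∷ ( 0ℤ ∷  1ℤ ∷ 0ℤ ∷  0ℤ ∷ [])
    ∷ ( 1ℤ ∷  1ℤ ∷ 1ℤ ∷ -2ℤ ∷ [])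
    ∷ (-1ℤ ∷ -1ℤ ∷ 0ℤ ∷  1ℤ ∷ [])
    ∷ [])

UVW : Fin 3 → Group.Carrier (GL 4)
UVW 0F = U
UVW 1F = V
UVW 2F = W

UVW⁻¹ : Fin 3 → Group.Carrier (GL 4)
UVW⁻¹ k = UVW k ⁻¹
  where open Group (GL 4)

Γ : Subgroup (GL 4) 0ℓ
Γ = subgroupGeneratedBy (GL 4) UVW

γ⁺ γ⁻ : Pred (Group.Carrier (GL 4)) 0ℓ
γ⁺ = semigroupGeneratedBy (GL 4) UVW
γ⁻ = semigroupGeneratedBy (GL 4) UVW⁻¹

{-# OPTIONS --safe #-}

-- Ω consists of the permutation matrices of the first three coordinates, with
-- the sign of the permutation in the fourth diagonal entry.  For i ≠ j the
-- transposition s = U_i U_j⁻¹ U_i lies in Ω, so U_i⁻¹ U_j = U_j⁻¹ s, and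
-- conjugation by s permutes the generators while inverting them.  Hence the
-- elements P ω are stable under left multiplication by every U_k and U_k⁻¹: a
-- letter of the wrong sign either cancels or flips the sign of the whole word.
--
-- Freeness of γ⁺ is ping-pong on the last column, which for a word of γ⁺ lies in
-- the cone x ≥ 0, x₃ > 0; its strictly largest entry among the first three is at
-- the index of the first letter.  Conjugation by diag(1,1,1,-1) inverts the
-- generators and carries the result over to γ⁻.
module Submission where

open import Defs
open import Algebra.Bundles using (Group)
open import Algebra.Properties.Group as GroupProperties using ()
open import Algebra.Properties.Semiring.Sum as Sum using ()
open import Data.Fin.Base using (Fin; zero; suc; toℕ; punchIn; combine; remQuot; inject₁)
open import Data.Fin.Patterns using (0F; 1F; 2F; 3F; 4F; 5F)
open import Data.Fin.Permutation as Perm using (Permutation′; _⟨$⟩ʳ_; _∘ₚ_; transpose)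
open import Data.Fin.Properties as Fin using (all?; any?)
open import Data.Integer.Base using (ℤ; 0ℤ; 1ℤ; -1ℤ; _*_; _^_; _≤_; _<_; nonNegative; positive)
open import Data.Integer.Properties as ℤ using ()
open import Data.Integer.Tactic.RingSolver using (ring)
open import Data.List.Base using (List; []; _∷_; map; foldr)
open import Data.List.NonEmpty.Base using (_∷_)
open import Data.List.Properties using (map-id)
open import Data.Nat.Base as ℕ using (ℕ; zero; suc)
open import Data.Product.Base using (∃; ∃₂; _×_; _,_; proj₁; proj₂; uncurry)
open import Data.Sign.Base as Sign using (Sign; opposite)
open import Data.Sum.Base using (_⊎_; inj₁; inj₂)
open import Data.Vec.Base using (Vec; []; _∷_; lookup; tabulate)
open import Data.Vec.Functional as Vector using (Vector)
open import Function.Base using (id; _∘_)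
open import Function.Bundles using (Inverse; Injection)
open import Function.Properties.Inverse using (↔⇒↣)
open import Level using (Level; 0ℓ)
open import Relation.Binary.Definitions using (DecidableEquality)
open import Relation.Binary.PropositionalEquality as ≡ using (_≡_; _≢_; refl; cong; cong₂; subst; setoid)
open import Relation.Nullary.Decidable using (Dec; decidable-stable; yes; no; from-yes; from-no; ¬?; _×-dec_; _→-dec_)
open import Relation.Nullary.Negation using (¬_; contradiction)
open import Relation.Unary using (Pred; _∈_; _⊆_; _⊂_)
open import Tactic.RingSolver.NonReflective ring using (Expr; Κ; Ι; _⊕_; _⊗_; module Ops)
open Sum ℤ.+-*-semiring using (sum; sum-cong-≋)

private
  variable
    a c ℓ p : Level

-- Words in a group and criteria for free generation.

module _ (G : Group c ℓ) where
  open Group G hiding (refl)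
  open GroupProperties G using (∙-cancelˡ)
  open import Relation.Binary.Reasoning.Setoid (Group.setoid G)

  -- Unlike `evalWord`, this admits the empty word, so the case P = I is included and inductions can
  -- start at `ε`.
  product : {I : Set a} → (I → Carrier) → List I → Carrier
  product S = foldr (λ k → S k ∙_) ε

  product≈evalWord : {I : Set a} (S : I → Carrier) → ∀ k ks →
                     product S (k ∷ ks) ≈ evalWord G S (k ∷ ks)
  product≈evalWord S k []       = identityʳ (S k)
  product≈evalWord S k (j ∷ js) = ∙-congˡ (product≈evalWord S j js)

  -- The element `s` moves past one letter at a time. This serves twice: to push an element of Ω
  -- through a word, inverting its letters, and, with `π = id`, to conjugate by the reflection.
  product-intertwine : {I : Set a} {S T : I → Carrier} {s : Carrier} (π : I → I) →
                       (∀ k → s ∙ S k ≈ T (π k) ∙ s) →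
                       ∀ ks → s ∙ product S ks ≈ product T (map π ks) ∙ s
  product-intertwine {s = s} π eq []       = trans (identityʳ s) (sym (identityˡ s))
  product-intertwine {S = S} {T} {s} π eq (k ∷ ks) = begin
    s ∙ (S k ∙ product S ks)                  ≈⟨ assoc _ _ _ ⟨
    (s ∙ S k) ∙ product S ks                  ≈⟨ ∙-congʳ (eq k) ⟩
    (T (π k) ∙ s) ∙ product S ks              ≈⟨ assoc _ _ _ ⟩
    T (π k) ∙ (s ∙ product S ks)              ≈⟨ ∙-congˡ (product-intertwine π eq ks) ⟩
    T (π k) ∙ (product T (map π ks) ∙ s)      ≈⟨ assoc _ _ _ ⟨
    (T (π k) ∙ product T (map π ks)) ∙ s      ∎

  ProductInjective : {I : Set a} → (I → Carrier) → Set _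
  ProductInjective S = ∀ js ks → product S js ≈ product S ks → js ≡ ks

  product-injective⇒free : {I : Set a} (S : I → Carrier) →
                           ProductInjective S → FreelyGenerated G S
  product-injective⇒free S inj (j ∷ js) (k ∷ ks) eq
    with refl ← inj (j ∷ js) (k ∷ ks) (begin
      product S (j ∷ js)     ≈⟨ product≈evalWord S j js ⟩
      evalWord G S (j ∷ js)  ≈⟨ eq ⟩
      evalWord G S (k ∷ ks)  ≈⟨ product≈evalWord S k ks ⟨
      product S (k ∷ ks)     ∎)
    = refl

  -- Equal first letters cancel, and the tails are compared by induction. If one word runs out
  -- first, the rest of the other is a nonempty word equal to `ε`, which the first hypothesis
  -- excludes.
  product-injective : {I : Set a} (S : I → Carrier) →
    (∀ k ks → ¬ product S (k ∷ ks) ≈ ε) →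
    (∀ j js k ks → product S (j ∷ js) ≈ product S (k ∷ ks) → j ≡ k) →
    ProductInjective S
  product-injective S ≉ε head []       []       eq = refl
  product-injective S ≉ε head []       (k ∷ ks) eq = contradiction (sym eq) (≉ε k ks)
  product-injective S ≉ε head (j ∷ js) []       eq = contradiction eq (≉ε j js)
  product-injective S ≉ε head (j ∷ js) (k ∷ ks) eq with refl ← head j js k ks eq =
    cong (j ∷_) (product-injective S ≉ε head js ks (∙-cancelˡ (S j) _ _ eq))

  product-injective-conj : {I : Set a} (S T : I → Carrier) (d : Carrier) →
    (∀ k → d ∙ S k ≈ T k ∙ d) → ProductInjective S → ProductInjective T
  product-injective-conj S T d eq inj js ks T≈ = inj js ks (∙-cancelˡ d _ _ (begin
    d ∙ product S js  ≈⟨ conj js ⟩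
    product T js ∙ d  ≈⟨ ∙-congʳ T≈ ⟩
    product T ks ∙ d  ≈⟨ conj ks ⟨
    d ∙ product S ks  ∎))
    where
    conj : ∀ ks → d ∙ product S ks ≈ product T ks ∙ d
    conj ks = subst (λ ls → d ∙ product S ks ≈ product T ls ∙ d) (map-id ks)
                    (product-intertwine id eq ks)

-- Factorisations P ω from exchange relations.

module _ (G : Group c ℓ) {I : Set a} (_≟_ : DecidableEquality I) (S : I → Group.Carrier G)
         (Ω : Subgroup G p) where
  open Group G hiding (refl)
  open GroupProperties G using (⁻¹-anti-homo-∙)
  open import Relation.Binary.Reasoning.Setoid (Group.setoid G)

  letter : Sign → I → Carrier
  letter Sign.+ k = S k
  letter Sign.- k = S k ⁻¹

  Factored : Pred Carrier _
  Factored g = ∃₂ λ s ks → ∃ λ ω → ω ∈ members Ω × g ≈ product G (letter s) ks ∙ ω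

  -- The first equation handles a letter of the wrong sign in front of a word. The twist by `π` lets
  -- `ω` pass through the rest of the word, giving all its letters the sign of the new first letter.
  Exchange : Set _
  Exchange = ∀ s i j → i ≢ j → ∃ λ ω → ω ∈ members Ω
    × letter (opposite s) i ∙ letter s j ≈ letter (opposite s) j ∙ ω
    × ∃ λ (π : I → I) → ∀ l → ω ∙ letter s l ≈ letter (opposite s) (π l) ∙ ω

  letter-inverse : ∀ s k → letter (opposite s) k ∙ letter s k ≈ ε
  letter-inverse Sign.+ k = inverseˡ (S k)
  letter-inverse Sign.- k = inverseʳ (S k)

  Factored-resp : ∀ {g h} → g ≈ h → Factored g → Factored h
  Factored-resp g≈h (s , ks , ω , ω∈ , eq) = s , ks , ω , ω∈ , trans (sym g≈h) eq

  module _ (exchange : Exchange) where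

    private
      same : ∀ s k ks {ω g} → ω ∈ members Ω → g ≈ product G (letter s) ks ∙ ω →
             Factored (letter s k ∙ g)
      same s k ks {ω} ω∈ eq = s , k ∷ ks , ω , ω∈ , trans (∙-congˡ eq) (sym (assoc _ _ _))

      opp : ∀ s k ks {ω g} → ω ∈ members Ω → g ≈ product G (letter s) ks ∙ ω →
            Factored (letter (opposite s) k ∙ g)
      -- The empty word has no sign of its own, so the new one-letter word may take the opposite
      -- sign.
      opp s k [] {ω} ω∈ eq = opposite s , k ∷ [] , ω , ω∈ ,
        trans (∙-congˡ (trans eq (identityˡ ω))) (∙-congʳ (sym (identityʳ _)))
      opp s k (j ∷ js) {ω} {g} ω∈ eq with k ≟ j
      ... | yes refl = s , js , ω , ω∈ , (begin
        letter s⁻ k ∙ g                              ≈⟨ ∙-congˡ (trans eq (assoc _ _ _)) ⟩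
        letter s⁻ k ∙ (letter s k ∙ (P ∙ ω))         ≈⟨ assoc _ _ _ ⟨
        (letter s⁻ k ∙ letter s k) ∙ (P ∙ ω)         ≈⟨ ∙-congʳ (letter-inverse s k) ⟩
        ε ∙ (P ∙ ω)                                  ≈⟨ identityˡ _ ⟩
        P ∙ ω                                        ∎)
        where
        s⁻ = opposite s
        P = product G (letter s) js
      -- The exchange leaves `ρ` behind the new first letter. Moving it through `js` flips the
      -- remaining letters, and it is then absorbed into Ω as `ρ ∙ ω`.
      ... | no k≢j with ρ , ρ∈ , kj≈ , π , ρ-twist ← exchange s k j k≢j =
        s⁻ , j ∷ map π js , ρ ∙ ω , Subgroup.∙-closed Ω ρ∈ ω∈ , (begin
        letter s⁻ k ∙ g                              ≈⟨ ∙-congˡ (trans eq (assoc _ _ _)) ⟩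
        letter s⁻ k ∙ (letter s j ∙ (P ∙ ω))         ≈⟨ assoc _ _ _ ⟨
        (letter s⁻ k ∙ letter s j) ∙ (P ∙ ω)         ≈⟨ ∙-congʳ kj≈ ⟩
        (letter s⁻ j ∙ ρ) ∙ (P ∙ ω)                  ≈⟨ assoc _ _ _ ⟩
        letter s⁻ j ∙ (ρ ∙ (P ∙ ω))                  ≈⟨ ∙-congˡ (assoc _ _ _) ⟨
        letter s⁻ j ∙ ((ρ ∙ P) ∙ ω)                  ≈⟨ ∙-congˡ (∙-congʳ (product-intertwine G π ρ-twist js)) ⟩
        letter s⁻ j ∙ ((P′ ∙ ρ) ∙ ω)                 ≈⟨ ∙-congˡ (assoc _ _ _) ⟩
        letter s⁻ j ∙ (P′ ∙ (ρ ∙ ω))                 ≈⟨ assoc _ _ _ ⟨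
        (letter s⁻ j ∙ P′) ∙ (ρ ∙ ω)                 ∎)
        where
        s⁻ = opposite s
        P = product G (letter s) js
        P′ = product G (letter s⁻) (map π js)

    letter∙Factored : ∀ s k {g} → Factored g → Factored (letter s k ∙ g)
    letter∙Factored Sign.+ k (Sign.+ , ks , _ , ω∈ , eq) = same Sign.+ k ks ω∈ eq
    letter∙Factored Sign.+ k (Sign.- , ks , _ , ω∈ , eq) = opp  Sign.- k ks ω∈ eq
    letter∙Factored Sign.- k (Sign.+ , ks , _ , ω∈ , eq) = opp  Sign.+ k ks ω∈ eq
    letter∙Factored Sign.- k (Sign.- , ks , _ , ω∈ , eq) = same Sign.- k ks ω∈ eq

    -- The claims for `g` and `g ⁻¹` are proved together because the constructor `inv` interchanges
    -- them.
    Generated∙Factored : ∀ {g} → Generated G S g →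
      (∀ {h} → Factored h → Factored (g ∙ h)) × (∀ {h} → Factored h → Factored (g ⁻¹ ∙ h))
    Generated∙Factored (gen k)   = letter∙Factored Sign.+ k , letter∙Factored Sign.- k
    Generated∙Factored unit      =
      (λ F → Factored-resp (sym (identityˡ _)) F) ,
      (λ F → Factored-resp (sym (trans (∙-congʳ (GroupProperties.ε⁻¹≈ε G)) (identityˡ _))) F)
    Generated∙Factored (mul {x} {y} x∈ y∈) =
      let x∙ , x⁻¹∙ = Generated∙Factored x∈ ; y∙ , y⁻¹∙ = Generated∙Factored y∈ in
      (λ F → Factored-resp (sym (assoc x y _)) (x∙ (y∙ F))) ,
      (λ F → Factored-resp (sym (trans (∙-congʳ (⁻¹-anti-homo-∙ x y)) (assoc _ _ _))) (y⁻¹∙ (x⁻¹∙ F)))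
    Generated∙Factored (inv {x} x∈) =
      let x∙ , x⁻¹∙ = Generated∙Factored x∈ in
      x⁻¹∙ , λ F → Factored-resp (∙-congʳ (sym (GroupProperties.⁻¹-involutive G x))) (x∙ F)
    Generated∙Factored (resp x≈y x∈) =
      let x∙ , x⁻¹∙ = Generated∙Factored x∈ in
      (λ F → Factored-resp (∙-congʳ x≈y) (x∙ F)) ,
      (λ F → Factored-resp (∙-congʳ (⁻¹-cong x≈y)) (x⁻¹∙ F))

    Generated⇒Factored : ∀ {g} → Generated G S g → Factored g
    Generated⇒Factored {g} g∈ = Factored-resp (identityʳ g)
      (proj₁ (Generated∙Factored g∈)
        -- The trivial factorisation of `ε`; the sign attached to the empty word is arbitrary.
        (Sign.+ , [] , ε , Subgroup.ε-closed Ω , sym (identityˡ ε)))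

    factorise : ∀ g → Generated G S g → ∃₂ λ P ω → ω ∈ members Ω
      × (P ∈ semigroupGeneratedBy G S
        ⊎ P ∈ semigroupGeneratedBy G (λ k → S k ⁻¹)
        ⊎ P ≈ ε)
      × g ≈ P ∙ ω
    factorise g g∈ with s , ks , ω , ω∈ , eq ← Generated⇒Factored g∈ =
      product G (letter s) ks , ω , ω∈ , side s ks , eq
      where
      side : ∀ s ks → let P = product G (letter s) ks in
        P ∈ semigroupGeneratedBy G S ⊎ P ∈ semigroupGeneratedBy G (λ k → S k ⁻¹) ⊎ P ≈ ε
      side s      []       = inj₂ (inj₂ (Group.refl G))
      side Sign.+ (k ∷ ks) = inj₁ (k ∷ ks , product≈evalWord G S k ks)
      side Sign.- (k ∷ ks) = inj₂ (inj₁ (k ∷ ks , product≈evalWord G (λ k → S k ⁻¹) k ks))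

-- Finite subgroups given by an indexed list of elements.

module _ (G : Group c ℓ) {c′ ℓ′} (H : Group c′ ℓ′) {n : ℕ}
         (element : Fin n → Group.Carrier G) (φ : Fin n → Group.Carrier H) where

  private
    module G = Group G
    module H = Group H

  module _
    (ε-index : ∃ λ k → G.ε G.≈ element k × φ k H.≈ H.ε)
    (∙-index : ∀ i j → ∃ λ k → element i G.∙ element j G.≈ element k × φ k H.≈ φ i H.∙ φ j)
    (⁻¹-index : ∀ j → ∃ λ k → element j G.⁻¹ G.≈ element k × φ k H.≈ φ j H.⁻¹)
    where

    -- Each index hypothesis supplies one `k` for both groups: its `G` half gives closure here, its
    -- `H` half the homomorphism laws in `finiteSubgroup-≅`.
    finiteSubgroup : Subgroup G ℓ
    finiteSubgroup = record
      { members   = λ g → ∃ λ k → g G.≈ element k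
      ; resp-≈    = λ x≈y (k , x≈) → k , G.trans (G.sym x≈y) x≈
      ; ε-closed  = proj₁ ε-index , proj₁ (proj₂ ε-index)
      ; ∙-closed  = λ (i , x≈) (j , y≈) →
          proj₁ (∙-index i j) , G.trans (G.∙-cong x≈ y≈) (proj₁ (proj₂ (∙-index i j)))
      ; ⁻¹-closed = λ (j , x≈) →
          proj₁ (⁻¹-index j) , G.trans (G.⁻¹-cong x≈) (proj₁ (proj₂ (⁻¹-index j)))
      }

    module _ (element-injective : ∀ j k → element j G.≈ element k → j ≡ k) where

      private
        -- Membership proofs carry an index; this makes reading it off a well-defined function of
        -- the group element.
        index-unique : ∀ {x y j k} → x G.≈ element j → y G.≈ element k → x G.≈ y → j ≡ k
        index-unique x≈ y≈ x≈y =
          element-injective _ _ (G.trans (G.sym x≈) (G.trans x≈y y≈))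

      finiteSubgroup-enumeration :
        Inverse (setoid (Fin n)) (Group.setoid (Subgroup.group finiteSubgroup))
      finiteSubgroup-enumeration = record
        { to        = λ k → element k , k , G.refl
        ; from      = λ (_ , k , _) → k
        ; to-cong   = λ { refl → G.refl }
        ; from-cong = λ {(_ , _ , x≈)} {(_ , _ , y≈)} → index-unique x≈ y≈
        ; inverse   = (λ { {_ , _ , x≈} refl → G.sym x≈ })
                    , (λ {_} {(_ , _ , y≈)} y≈k → index-unique y≈ G.refl y≈k)
        }

      finiteSubgroup-≅ :
        (∀ j k → φ j H.≈ φ k → j ≡ k) → (∀ h → ∃ λ k → φ k H.≈ h) →
        Subgroup.group finiteSubgroup ≅ H
      finiteSubgroup-≅ φ-injective φ-surjective = (λ (_ , k , _) → φ k) , record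
        { isGroupMonomorphism = record
          { isGroupHomomorphism = record
            { isMonoidHomomorphism = record
              { isMagmaHomomorphism = record
                { isRelHomomorphism = record
                  { cong = λ {(_ , _ , x≈)} {(_ , _ , y≈)} x≈y →
                      H.reflexive (cong φ (index-unique x≈ y≈ x≈y)) }
                ; homo = λ (_ , i , _) (_ , j , _) → proj₂ (proj₂ (∙-index i j))
                }
              ; ε-homo = proj₂ (proj₂ ε-index)
              }
            ; ⁻¹-homo = λ (_ , j , _) → proj₂ (proj₂ (⁻¹-index j))
            }
          ; injective = λ {(_ , j , x≈)} {(_ , k , y≈)} φj≈φk →
              G.trans x≈ (G.trans (G.reflexive (cong element (φ-injective j k φj≈φk))) (G.sym y≈))
          }
        ; surjective = λ h → let k , φk≈h = φ-surjective h in
            (element k , k , G.refl) , λ {(_ , j , z≈)} z≈k →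
              H.trans (H.reflexive (cong φ (index-unique z≈ G.refl z≈k))) φk≈h
        }

-- Ping-pong on the last column: freeness of γ⁺.

sum-mono-≤ : ∀ {n} {f g : Vector ℤ n} → (∀ l → f l ≤ g l) → sum f ≤ sum g
sum-mono-≤ {zero}  f≤g = ℤ.≤-refl
sum-mono-≤ {suc n} f≤g = ℤ.+-mono-≤ (f≤g zero) (sum-mono-≤ (f≤g ∘ suc))

sum-mono-< : ∀ {n} {f g : Vector ℤ n} k → (∀ l → f l ≤ g l) → f k < g k → sum f < sum g
sum-mono-< zero    f≤g f<g = ℤ.+-mono-<-≤ f<g (sum-mono-≤ (f≤g ∘ suc))
sum-mono-< (suc k) f≤g f<g = ℤ.+-mono-≤-< (f≤g zero) (sum-mono-< k (f≤g ∘ suc) f<g)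

infix 7 _·_

_·_ : ∀ {n} → Vector ℤ n → Vector ℤ n → ℤ
r · x = sum λ l → r l * x l

0ⱽ : Vector ℤ 4
0ⱽ _ = 0ℤ

-- Only the fourth entry must be positive, so the last column (0, 0, 0, 1) of the identity qualifies
-- and starts the induction.
Cone : Pred (Vector ℤ 4) 0ℓ
Cone x = (∀ l → 0ℤ ≤ x l) × 0ℤ < x 3F

-- Strictness is placed at the coordinate where every vector of `Cone` is positive; hence `r ≪ s`
-- forces `r · x < s · x` on the whole cone.
_≪_ : Vector ℤ 4 → Vector ℤ 4 → Set
r ≪ s = (∀ l → r l ≤ s l) × r 3F < s 3F

_≪?_ : ∀ r s → Dec (r ≪ s)
r ≪? s = all? (λ l → r l ℤ.≤? s l) ×-dec r 3F ℤ.<? s 3F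

·-mono-≤ : ∀ r s x → Cone x → (∀ l → r l ≤ s l) → r · x ≤ s · x
·-mono-≤ r s x (x≥0 , _) r≤s =
  sum-mono-≤ λ l → ℤ.*-monoʳ-≤-nonNeg (x l) {{nonNegative (x≥0 l)}} (r≤s l)

·-mono-< : ∀ r s x → Cone x → r ≪ s → r · x < s · x
·-mono-< r s x (x≥0 , x₃>0) (r≤s , r<s) = sum-mono-< 3F
  (λ l → ℤ.*-monoʳ-≤-nonNeg (x l) {{nonNegative (x≥0 l)}} (r≤s l))
  (ℤ.*-monoʳ-<-pos (x 3F) {{positive x₃>0}} r<s)

matrix : Fin 3 → Matrix 4
matrix k = Unit.value (UVW k)

matrix-nonneg : ∀ k j l → 0ℤ ≤ matrix k j l
matrix-nonneg = from-yes (all? λ k → all? λ j → all? λ l → 0ℤ ℤ.≤? matrix k j l)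

matrix-last : ∀ k → 0ⱽ ≪ matrix k 3F
matrix-last = from-yes (all? λ k → 0ⱽ ≪? matrix k 3F)

matrix-own : ∀ k → 0ⱽ ≪ matrix k (inject₁ k)
matrix-own = from-yes (all? λ k → 0ⱽ ≪? matrix k (inject₁ k))

-- Row `k` is (1, 1, 1, 2), and the other two of the first three rows are standard basis vectors
-- ending in 0.
matrix-dominant : ∀ k j → j ≢ k → matrix k (inject₁ j) ≪ matrix k (inject₁ k)
matrix-dominant = from-yes (all? λ k → all? λ j →
  ¬? (j Fin.≟ k) →-dec (matrix k (inject₁ j) ≪? matrix k (inject₁ k)))

-- This is the image of the fourth basis vector under the word, so prepending a letter applies its
-- matrix to the vector.
lastColumn : List (Fin 3) → Vector ℤ 4
lastColumn ks j = Unit.value (product (GL 4) UVW ks) j 3F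

lastColumn∈Cone : ∀ ks → lastColumn ks ∈ Cone
lastColumn∈Cone []       =
  from-yes ((all? λ l → 0ℤ ℤ.≤? lastColumn [] l) ×-dec 0ℤ ℤ.<? lastColumn [] 3F)
lastColumn∈Cone (k ∷ ks) =
  (λ j → ·-mono-≤ 0ⱽ (matrix k j) x x∈ (matrix-nonneg k j)) ,
  ·-mono-< 0ⱽ (matrix k 3F) x x∈ (matrix-last k)
  where
  x = lastColumn ks
  x∈ = lastColumn∈Cone ks

lastColumn-own : ∀ k ks → 0ℤ < lastColumn (k ∷ ks) (inject₁ k)
lastColumn-own k ks =
  ·-mono-< 0ⱽ (matrix k (inject₁ k)) (lastColumn ks) (lastColumn∈Cone ks) (matrix-own k)

lastColumn-dominant : ∀ k ks j → j ≢ k →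
                      lastColumn (k ∷ ks) (inject₁ j) < lastColumn (k ∷ ks) (inject₁ k)
lastColumn-dominant k ks j j≢k =
  ·-mono-< (matrix k (inject₁ j)) (matrix k (inject₁ k)) (lastColumn ks)
    (lastColumn∈Cone ks) (matrix-dominant k j j≢k)

lastColumn-[] : ∀ k → lastColumn [] (inject₁ k) ≡ 0ℤ
lastColumn-[] = from-yes (all? λ k → lastColumn [] (inject₁ k) ℤ.≟ 0ℤ)

lastColumn-cong : ∀ js ks → Group._≈_ (GL 4) (product (GL 4) UVW js) (product (GL 4) UVW ks) →
                  ∀ j → lastColumn js j ≡ lastColumn ks j
lastColumn-cong js ks eq j = eq j 3F

lastColumn-≢[] : ∀ k ks → ¬ (∀ j → lastColumn (k ∷ ks) j ≡ lastColumn [] j)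
lastColumn-≢[] k ks eq = ℤ.<-irrefl {0ℤ} {lastColumn (k ∷ ks) (inject₁ k)}
  (≡.sym (≡.trans (eq (inject₁ k)) (lastColumn-[] k))) (lastColumn-own k ks)

-- A with-abstraction on j ≟ k would normalise the type of eq, which is huge.
lastColumn-head : ∀ j js k ks → (∀ i → lastColumn (j ∷ js) i ≡ lastColumn (k ∷ ks) i) → j ≡ k
lastColumn-head j js k ks eq = decidable-stable (j Fin.≟ k) λ j≢k → ℤ.<-irrefl refl (begin-strict
  lastColumn (j ∷ js) (inject₁ k)  <⟨ lastColumn-dominant j js k (j≢k ∘ ≡.sym) ⟩
  lastColumn (j ∷ js) (inject₁ j)  ≡⟨ eq (inject₁ j) ⟩
  lastColumn (k ∷ ks) (inject₁ j)  <⟨ lastColumn-dominant k ks j j≢k ⟩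
  lastColumn (k ∷ ks) (inject₁ k)  ≡⟨ eq (inject₁ k) ⟨
  lastColumn (j ∷ js) (inject₁ k)  ∎)
  where open ℤ.≤-Reasoning

UVW-product-injective : ProductInjective (GL 4) UVW
UVW-product-injective = product-injective (GL 4) UVW
  (λ k ks eq → lastColumn-≢[] k ks (lastColumn-cong (k ∷ ks) [] eq))
  (λ j js k ks eq → lastColumn-head j js k ks (lastColumn-cong (j ∷ js) (k ∷ ks) eq))

-- Transfer of freeness to γ⁻.

reflection : Group.Carrier (GL 4)
reflection = record
  { value    = D
  ; inverse  = D
  ; inverseˡ = from-yes (D *ᴹ D ≟ᴹ 1ᴹ)
  ; inverseʳ = from-yes (D *ᴹ D ≟ᴹ 1ᴹ)
  }
  where
  D : Matrix 4
  D = fromRows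
    ( (1ℤ ∷ 0ℤ ∷ 0ℤ ∷  0ℤ ∷ [])
    ∷ (0ℤ ∷ 1ℤ ∷ 0ℤ ∷  0ℤ ∷ [])
    ∷ (0ℤ ∷ 0ℤ ∷ 1ℤ ∷  0ℤ ∷ [])
    ∷ (0ℤ ∷ 0ℤ ∷ 0ℤ ∷ -1ℤ ∷ [])
    ∷ [])

module _ where
  open Group (GL 4) using (_≈_; _∙_; ε; _⁻¹)

  infix 4 _≟ᴳ_

  _≟ᴳ_ : ∀ g h → Dec (g ≈ h)
  g ≟ᴳ h = Unit.value g ≟ᴹ Unit.value h

  reflection-inverts : ∀ k → reflection ∙ UVW k ≈ UVW⁻¹ k ∙ reflection
  reflection-inverts = from-yes (all? λ k → reflection ∙ UVW k ≟ᴳ UVW⁻¹ k ∙ reflection)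

  UVW⁻¹-product-injective : ProductInjective (GL 4) UVW⁻¹
  UVW⁻¹-product-injective = product-injective-conj (GL 4) UVW UVW⁻¹ reflection
    reflection-inverts UVW-product-injective

  -- The six-element group Ω and its isomorphism with S₃.

  signedPermRows : Fin 6 → Vec (Vec ℤ 4) 4
  signedPermRows = lookup
    ( (e₁ ∷ e₂ ∷ e₃ ∷  e₄ ∷ [])
    ∷ (e₂ ∷ e₁ ∷ e₃ ∷ -e₄ ∷ [])
    ∷ (e₁ ∷ e₃ ∷ e₂ ∷ -e₄ ∷ [])
    ∷ (e₃ ∷ e₂ ∷ e₁ ∷ -e₄ ∷ [])
    ∷ (e₂ ∷ e₃ ∷ e₁ ∷  e₄ ∷ [])
    ∷ (e₃ ∷ e₁ ∷ e₂ ∷  e₄ ∷ [])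
    ∷ [])
    where
    e₁ e₂ e₃ e₄ -e₄ : Vec ℤ 4
    e₁  = 1ℤ ∷ 0ℤ ∷ 0ℤ ∷  0ℤ ∷ []
    e₂  = 0ℤ ∷ 1ℤ ∷ 0ℤ ∷  0ℤ ∷ []
    e₃  = 0ℤ ∷ 0ℤ ∷ 1ℤ ∷  0ℤ ∷ []
    e₄  = 0ℤ ∷ 0ℤ ∷ 0ℤ ∷  1ℤ ∷ []
    -e₄ = 0ℤ ∷ 0ℤ ∷ 0ℤ ∷ -1ℤ ∷ []

  signedPermMatrix : Fin 6 → Matrix 4
  signedPermMatrix k = fromRows (signedPermRows k)

  -- The two 3-cycles are inverse to each other; the identity and the transpositions are
  -- self-inverse.
  inverseIndex : Fin 6 → Fin 6
  inverseIndex 4F = 5F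
  inverseIndex 5F = 4F
  inverseIndex k  = k

  signedPerm : Fin 6 → Group.Carrier (GL 4)
  signedPerm k = record
    { value    = M k
    ; inverse  = M (inverseIndex k)
    -- The decision procedure evaluates only on closed terms, so all six indices are checked at once
    -- and the result is applied to `k`.
    ; inverseˡ = from-yes (all? λ k → M (inverseIndex k) *ᴹ M k ≟ᴹ 1ᴹ) k
    ; inverseʳ = from-yes (all? λ k → M k *ᴹ M (inverseIndex k) ≟ᴹ 1ᴹ) k
    }
    where M = signedPermMatrix

  -- signedPerm k sends the basis vector e_i to e_{π i} for π = underlying k, so the
  -- rows listed above are permuted by π⁻¹.
  underlying : Fin 6 → Permutation′ 3
  underlying 0F = Perm.id
  underlying 1F = transpose 0F 1F
  underlying 2F = transpose 1F 2F
  underlying 3F = transpose 0F 2F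
  underlying 4F = transpose 0F 1F ∘ₚ transpose 1F 2F
  underlying 5F = transpose 1F 2F ∘ₚ transpose 0F 1F

  private
    module S₃ = Group (symmetricGroup 3)

    infix 4 _≟ˢ_

    _≟ˢ_ : ∀ π ρ → Dec (π S₃.≈ ρ)
    π ≟ˢ ρ = all? λ k → (π ⟨$⟩ʳ k) Fin.≟ (ρ ⟨$⟩ʳ k)

  ε-index : ∃ λ k → ε ≈ signedPerm k × underlying k S₃.≈ S₃.ε
  ε-index = from-yes (any? λ k → (ε ≟ᴳ signedPerm k) ×-dec (underlying k ≟ˢ S₃.ε))

  ∙-index : ∀ i j → ∃ λ k → signedPerm i ∙ signedPerm j ≈ signedPerm k
                          × underlying k S₃.≈ underlying i S₃.∙ underlying j
  ∙-index = from-yes (all? λ i → all? λ j → any? λ k →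
    (signedPerm i ∙ signedPerm j ≟ᴳ signedPerm k) ×-dec (underlying k ≟ˢ underlying i S₃.∙ underlying j))

  ⁻¹-index : ∀ j → ∃ λ k → signedPerm j ⁻¹ ≈ signedPerm k × underlying k S₃.≈ underlying j S₃.⁻¹
  ⁻¹-index = from-yes (all? λ j → any? λ k →
    (signedPerm j ⁻¹ ≟ᴳ signedPerm k) ×-dec (underlying k ≟ˢ underlying j S₃.⁻¹))

  Ω : Subgroup (GL 4) 0ℓ
  Ω = finiteSubgroup (GL 4) (symmetricGroup 3) signedPerm underlying ε-index ∙-index ⁻¹-index

  signedPerm-injective : ∀ j k → signedPerm j ≈ signedPerm k → j ≡ k
  signedPerm-injective =
    from-yes (all? λ j → all? λ k → (signedPerm j ≟ᴳ signedPerm k) →-dec (j Fin.≟ k))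

  underlying-injective : ∀ j k → underlying j S₃.≈ underlying k → j ≡ k
  underlying-injective =
    from-yes (all? λ j → all? λ k → (underlying j ≟ˢ underlying k) →-dec (j Fin.≟ k))

  -- A permutation of three points is a triple of pairwise distinct values; in this form
  -- surjectivity is a finite check.
  underlying-hits : ∀ x y z → x ≢ y → y ≢ z → x ≢ z → ∃ λ k →
    underlying k ⟨$⟩ʳ 0F ≡ x × underlying k ⟨$⟩ʳ 1F ≡ y × underlying k ⟨$⟩ʳ 2F ≡ z
  underlying-hits = from-yes (all? λ x → all? λ y → all? λ z →
    ¬? (x Fin.≟ y) →-dec ¬? (y Fin.≟ z) →-dec ¬? (x Fin.≟ z) →-dec any? λ k →
      ((underlying k ⟨$⟩ʳ 0F) Fin.≟ x) ×-dec ((underlying k ⟨$⟩ʳ 1F) Fin.≟ y)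
        ×-dec ((underlying k ⟨$⟩ʳ 2F) Fin.≟ z))

  underlying-surjective : ∀ π → ∃ λ k → underlying k S₃.≈ π
  underlying-surjective π =
    let k , k0 , k1 , k2 = underlying-hits (π ⟨$⟩ʳ 0F) (π ⟨$⟩ʳ 1F) (π ⟨$⟩ʳ 2F)
          ((λ ()) ∘ π-injective) ((λ ()) ∘ π-injective) ((λ ()) ∘ π-injective)
    in k , λ { 0F → k0 ; 1F → k1 ; 2F → k2 }
    where
    π-injective : ∀ {i j} → π ⟨$⟩ʳ i ≡ π ⟨$⟩ʳ j → i ≡ j
    π-injective = Injection.injective (↔⇒↣ π)

  -- Exchange relations between the generators and Ω.

  private
    L = letter (GL 4) Fin._≟_ UVW Ω

  -- The condition `Exchange` with `ω` taken from the list and `π` its underlying permutation, which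
  -- makes the search for a witness finite.
  Exchanges : Sign → (i j : Fin 3) → Fin 6 → Set
  Exchanges s i j k =
      L (opposite s) i ∙ L s j ≈ L (opposite s) j ∙ signedPerm k
    × (∀ l → signedPerm k ∙ L s l ≈ L (opposite s) (underlying k ⟨$⟩ʳ l) ∙ signedPerm k)

  exchanges? : ∀ s i j k → Dec (Exchanges s i j k)
  exchanges? s i j k =
          (L (opposite s) i ∙ L s j ≟ᴳ L (opposite s) j ∙ signedPerm k)
    ×-dec (all? λ l → signedPerm k ∙ L s l ≟ᴳ L (opposite s) (underlying k ⟨$⟩ʳ l) ∙ signedPerm k)

  exchange-index : ∀ s i j → i ≢ j → ∃ (Exchanges s i j)
  exchange-index Sign.+ =
    from-yes (all? λ i → all? λ j → ¬? (i Fin.≟ j) →-dec any? (exchanges? Sign.+ i j))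
  exchange-index Sign.- =
    from-yes (all? λ i → all? λ j → ¬? (i Fin.≟ j) →-dec any? (exchanges? Sign.- i j))

  exchange : Exchange (GL 4) Fin._≟_ UVW Ω
  exchange s i j i≢j =
    let k , eq , twist = exchange-index s i j i≢j
    in signedPerm k , (k , λ _ _ → refl) , eq , (underlying k ⟨$⟩ʳ_) , twist

  -- Ω as a proper subgroup of Γ.

  signedPerm∈Γ : ∀ k → signedPerm k ∈ members Γ
  signedPerm∈Γ 0F = resp (from-yes (ε ≟ᴳ signedPerm 0F)) unit
  signedPerm∈Γ 1F = resp (from-yes (U ∙ (V ⁻¹ ∙ U) ≟ᴳ signedPerm 1F))
    (mul (gen 0F) (mul (inv (gen 1F)) (gen 0F)))
  signedPerm∈Γ 2F = resp (from-yes (V ∙ (W ⁻¹ ∙ V) ≟ᴳ signedPerm 2F))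
    (mul (gen 1F) (mul (inv (gen 2F)) (gen 1F)))
  signedPerm∈Γ 3F = resp (from-yes (U ∙ (W ⁻¹ ∙ U) ≟ᴳ signedPerm 3F))
    (mul (gen 0F) (mul (inv (gen 2F)) (gen 0F)))
  -- Each 3-cycle is a product of two transpositions. The factors stand in the opposite order to
  -- `underlying`, since `∘ₚ` applies its left argument first.
  signedPerm∈Γ 4F = resp (from-yes (signedPerm 2F ∙ signedPerm 1F ≟ᴳ signedPerm 4F))
    (mul (signedPerm∈Γ 2F) (signedPerm∈Γ 1F))
  signedPerm∈Γ 5F = resp (from-yes (signedPerm 1F ∙ signedPerm 2F ≟ᴳ signedPerm 5F))
    (mul (signedPerm∈Γ 1F) (signedPerm∈Γ 2F))

  Ω⊂Γ : members Ω ⊂ members Γ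
  Ω⊂Γ = (λ {g} (k , eq) → resp {x = signedPerm k} {y = g} (λ i j → ≡.sym (eq i j)) (signedPerm∈Γ k))
      -- The inclusion is proper because `U` is not a signed permutation matrix.
      , λ Γ⊆Ω → from-no (any? λ k → U ≟ᴳ signedPerm k) (Γ⊆Ω (gen 0F))

Ω-enumeration : Inverse (setoid (Fin 6)) (Group.setoid (Subgroup.group Ω))
Ω-enumeration =
  finiteSubgroup-enumeration (GL 4) (symmetricGroup 3) signedPerm underlying
    ε-index ∙-index ⁻¹-index signedPerm-injective

Ω≅S₃ : Subgroup.group Ω ≅ symmetricGroup 3
Ω≅S₃ =
  finiteSubgroup-≅ (GL 4) (symmetricGroup 3) signedPerm underlying
    ε-index ∙-index ⁻¹-index signedPerm-injective
    underlying-injective underlying-surjective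

Γ-factorisation : ∀ g → g ∈ members Γ → ∃₂ λ P ω → ω ∈ members Ω
  × (P ∈ γ⁺ ⊎ P ∈ γ⁻ ⊎ Group._≈_ (GL 4) P (Group.ε (GL 4)))
  × Group._≈_ (GL 4) g (Group._∙_ (GL 4) P ω)
Γ-factorisation = factorise (GL 4) Fin._≟_ UVW Ω exchange

-- Determinants: Γ lies in SL₄(ℤ).

det-cong : ∀ {n} {A B : Matrix n} → A ≈ᴹ B → det A ≡ det B
det-cong {zero}  A≈B = refl
det-cong {suc n} A≈B = sum-cong-≋ λ k → cong₂ _*_
  (cong ((-1ℤ ^ toℕ k) *_) (A≈B zero k))
  (det-cong λ j l → A≈B (suc j) (punchIn k l))

sumᴱ : ∀ {m n} → Vector (Expr ℤ m) n → Expr ℤ m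
sumᴱ = Vector.foldr _⊕_ (Κ 0ℤ)

-- The recursion copies that of `det`, so for a fixed size the expression evaluates to `det` by
-- computation.
detᴱ : ∀ {m n} → Vector (Vector (Expr ℤ m) n) n → Expr ℤ m
detᴱ {n = zero}  A = Κ 1ℤ
detᴱ {n = suc n} A = sumᴱ λ k →
  (Κ (-1ℤ ^ toℕ k) ⊗ A zero k) ⊗ detᴱ (λ j l → A (suc j) (punchIn k l))

_*ᴱ_ : ∀ {m n} → Matrix n → Vector (Vector (Expr ℤ m) n) n → Vector (Vector (Expr ℤ m) n) n
(A *ᴱ B) j k = sumᴱ λ l → Κ (A j l) ⊗ B l k

indeterminates : ∀ n → Vector (Vector (Expr ℤ (n ℕ.* n)) n) n
indeterminates n j k = Ι (combine j k)

-- The variable Ι (combine j k) of the solver evaluates to A j k.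
entries : ∀ {n} → Matrix n → Vec ℤ (n ℕ.* n)
entries {n} A = tabulate λ i → uncurry A (remQuot n i)

-- Both sides have the same normal form as polynomials in the sixteen entries of A.
det-matrix* : ∀ k A → det (matrix k *ᴹ A) ≡ det A
det-matrix* 0F A = Ops.prove (entries A)
  (detᴱ (matrix 0F *ᴱ indeterminates 4)) (detᴱ (indeterminates 4)) refl
det-matrix* 1F A = Ops.prove (entries A)
  (detᴱ (matrix 1F *ᴱ indeterminates 4)) (detᴱ (indeterminates 4)) refl
det-matrix* 2F A = Ops.prove (entries A)
  (detᴱ (matrix 2F *ᴱ indeterminates 4)) (detᴱ (indeterminates 4)) refl

module _ where
  open Group (GL 4) using (_≈_; _∙_; ε; _⁻¹; assoc; identityˡ; identityʳ; ∙-congʳ; sym)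

  detᴳ : Group.Carrier (GL 4) → ℤ
  detᴳ g = det (Unit.value g)

  detᴳ-cong : ∀ g h → g ≈ h → detᴳ g ≡ detᴳ h
  detᴳ-cong g h = det-cong {A = Unit.value g} {B = Unit.value h}

  -- Keeping `h` arbitrary carries the induction: a product uses the hypothesis at two different
  -- second factors, and an inverse uses that for `x` at `x ⁻¹ ∙ h`. The case `h = ε` then gives
  -- determinant 1.
  detᴳ-Γ : ∀ {g} → g ∈ members Γ → ∀ h → detᴳ (g ∙ h) ≡ detᴳ h
  detᴳ-Γ (gen k) h = det-matrix* k (Unit.value h)
  detᴳ-Γ unit    h = detᴳ-cong (ε ∙ h) h (identityˡ h)
  detᴳ-Γ (mul {x} {y} x∈ y∈) h = begin
    detᴳ ((x ∙ y) ∙ h)    ≡⟨ detᴳ-cong ((x ∙ y) ∙ h) (x ∙ (y ∙ h)) (assoc x y h) ⟩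
    detᴳ (x ∙ (y ∙ h))    ≡⟨ detᴳ-Γ x∈ (y ∙ h) ⟩
    detᴳ (y ∙ h)          ≡⟨ detᴳ-Γ y∈ h ⟩
    detᴳ h                ∎
    where open ≡.≡-Reasoning
  detᴳ-Γ (inv {x} x∈) h = begin
    detᴳ (x ⁻¹ ∙ h)          ≡⟨ detᴳ-Γ x∈ (x ⁻¹ ∙ h) ⟨
    detᴳ (x ∙ (x ⁻¹ ∙ h))    ≡⟨ detᴳ-cong (x ∙ (x ⁻¹ ∙ h)) h (GroupProperties.\\-leftDividesˡ (GL 4) x h) ⟩
    detᴳ h                   ∎
    where open ≡.≡-Reasoning
  detᴳ-Γ (resp {x} {y} x≈y x∈) h = begin
    detᴳ (y ∙ h)    ≡⟨ detᴳ-cong (x ∙ h) (y ∙ h) (∙-congʳ {h} {x} {y} x≈y) ⟨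
    detᴳ (x ∙ h)    ≡⟨ detᴳ-Γ x∈ h ⟩
    detᴳ h          ∎
    where open ≡.≡-Reasoning

  Γ⊆SL : members Γ ⊆ SL 4
  Γ⊆SL {g} g∈ = begin
    detᴳ g          ≡⟨ detᴳ-cong (g ∙ ε) g (identityʳ g) ⟨
    detᴳ (g ∙ ε)    ≡⟨ detᴳ-Γ g∈ ε ⟩
    detᴳ ε          ≡⟨⟩
    1ℤ              ∎
    where open ≡.≡-Reasoning

open Group (GL 4) using (_≈_; _∙_; ε)

theorem1 : members Γ ⊆ SL 4
    × (∃ λ (Ω : Subgroup (GL 4) 0ℓ) →
    members Ω ⊂ members Γ
    × Inverse (setoid (Fin 6)) (Group.setoid (Subgroup.group Ω))
    × Subgroup.group Ω ≅ symmetricGroup 3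
    × (∀ g → g ∈ members Γ → ∃₂ λ P ω →
    ω ∈ members Ω
    × (P ∈ γ⁺ ⊎ P ∈ γ⁻ ⊎ P ≈ ε)
    × g ≈ P ∙ ω))
    × FreelyGenerated (GL 4) UVW
    × FreelyGenerated (GL 4) UVW⁻¹
theorem1 =
    Γ⊆SL
  , (Ω , Ω⊂Γ , Ω-enumeration , Ω≅S₃ , Γ-factorisation)
  , product-injective⇒free (GL 4) UVW UVW-product-injective
  , product-injective⇒free (GL 4) UVW⁻¹ UVW⁻¹-product-injective
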